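{- Let $G$ be a finite simple connected graph which is not a complete graph. Then there is a nonedge $uv$ of $G$ such that $\beth^{1}(G/uv)\le \beth^{1}(G)$.
   Context: All graphs are finite and simple. A nonedge $uv$ is a pair of distinct nonadjacent vertices. $G/uv$ denotes the nonedge contraction of $uv$: the simple graph obtained by identifying $u$ and $v$ to a single vertex, adjacent to exactly those other vertices that are adjacent to $u$ or $v$ in $G$ (no loops or multiple edges; equivalently, add the edge $uv$ and contract it). The first graph characteristic is $\beth^{1}(G)=|E(G)|-|V(G)|$. -}

module Defs where

open import Data.Fin using (Fin; punchIn)
open import Data.Fin.Properties using (_≟_; _<?_)
open import Data.Integer using (ℤ; +_; _-_)
open import Data.List using (List; allFin; cartesianProduct; filter; length)
open import Data.Nat using (ℕ; zero; suc; pred)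
open import Data.Product using (_×_; _,_)
open import Data.Sum using (_⊎_; inj₁; inj₂)
open import Level using (0ℓ)
open import Relation.Binary using (Rel; Decidable; Symmetric)
open import Relation.Binary.Construct.Closure.ReflexiveTransitive using (Star)
open import Relation.Binary.PropositionalEquality using (_≡_; _≢_; subst)
open import Relation.Nullary using (¬_; _×-dec_; _⊎-dec_)

record Graph (n : ℕ) : Set₁ where
  field
    Adj    : Rel (Fin n) 0ℓ
    adj?   : Decidable Adj
    symm   : Symmetric Adj
    irrefl : ∀ {x} → ¬ Adj x x

open Graph public

Connected : ∀ {n} → Graph n → Set
Connected G = ∀ x y → Star (Adj G) x y

Complete : ∀ {n} → Graph n → Set
Complete G = ∀ x y → x ≢ y → Adj G x y

Nonedge : ∀ {n} → Graph n → Fin n → Fin n → Set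
Nonedge G u v = u ≢ v × ¬ Adj G u v

-- Each edge {x , y} is listed once, as the pair with x < y.
edges : ∀ {n} → Graph n → List (Fin n × Fin n)
edges {n} G =
  filter (λ (x , y) → (x <? y) ×-dec adj? G x y)
         (cartesianProduct (allFin n) (allFin n))

∣V∣ : ∀ {n} → Graph n → ℕ
∣V∣ {n} _ = n

∣E∣ : ∀ {n} → Graph n → ℕ
∣E∣ G = length (edges G)

ℶ¹ : ∀ {n} → Graph n → ℤ
ℶ¹ G = + ∣E∣ G - + ∣V∣ G

-- The contraction has the vertices of G other than v, numbered through
-- punchIn v : Fin n → Fin (suc n), and u plays the role of the merged vertex:
-- it keeps its own neighbours and inherits those of v.
infixl 7 _/_
_/_ : ∀ {n} (G : Graph n) {u v : Fin n} → Nonedge G u v → Graph (pred n)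
_/_ {zero} G {()}
_/_ {suc n} G {u} {v} (_ , u≁v) = record
  { Adj    = λ a b → Adj G (ι a) (ι b)
                   ⊎ (ι a ≡ u × Adj G v (ι b))
                   ⊎ (ι b ≡ u × Adj G v (ι a))
  ; adj?   = λ a b → adj? G (ι a) (ι b)
                   ⊎-dec ((ι a ≟ u) ×-dec adj? G v (ι b))
                   ⊎-dec ((ι b ≟ u) ×-dec adj? G v (ι a))
  ; symm   = λ { (inj₁ e)        → inj₁ (symm G e)
               ; (inj₂ (inj₁ e)) → inj₂ (inj₂ e)
               ; (inj₂ (inj₂ e)) → inj₂ (inj₁ e) }
  ; irrefl = λ { (inj₁ e)              → irrefl G e
               ; (inj₂ (inj₁ (eq , e))) → noLoop eq e
               ; (inj₂ (inj₂ (eq , e))) → noLoop eq e }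
  }
  where
  ι : Fin n → Fin (suc n)
  ι = punchIn v

  noLoop : ∀ {a} → ι a ≡ u → ¬ Adj G v (ι a)
  noLoop eq e = u≁v (symm G (subst (Adj G v) eq e))

{-# OPTIONS --safe #-}
module Submission where

-- Every walk between distinct nonadjacent vertices leads to a nonedge uv with a
-- common neighbour w. Its contraction loses one vertex, and it loses at least
-- one edge: each edge of G/uv is the image of an edge of G other than vw, since
-- vw and uw have the same image. Hence |E| − |V| does not increase.

open import Data.Fin using (Fin; punchIn; punchOut; _<_)
open import Data.Fin.Properties
  using (_≟_; _<?_; <-cmp; ¬∀⟶∃¬; all?; punchIn-injective; punchInᵢ≢i;
         punchIn-punchOut)
open import Data.Integer using (_≤_)
open import Data.Integer.Properties using (⊖-monoˡ-≤; m-n≡m⊖n; [1+m]⊖[1+n]≡m⊖n)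
open import Data.List using (List; []; _∷_; allFin; cartesianProduct; filter; length; map)
open import Data.List.Membership.Propositional using (_∈_; lose)
open import Data.List.Membership.Propositional.Properties
  using (∈-allFin; ∈-cartesianProduct⁺; ∈-filter⁺; ∈-filter⁻; ∈-map⁺)
open import Data.List.Properties using (filter-notAll; length-map)
open import Data.List.Relation.Binary.Subset.Propositional using (_⊆_)
open import Data.List.Relation.Unary.All using (lookup)
open import Data.List.Relation.Unary.AllPairs using (_∷_)
open import Data.List.Relation.Unary.Any using (here; there)
open import Data.List.Relation.Unary.Unique.Propositional using (Unique)
open import Data.List.Relation.Unary.Unique.Propositional.Properties
  using (allFin⁺; cartesianProduct⁺; filter⁺)
open import Data.Nat using (ℕ; zero; suc)
import Data.Nat as ℕ
import Data.Nat.Properties as ℕ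
open import Data.Product using (Σ-syntax; ∃-syntax; _×_; _,_; proj₁; proj₂)
open import Data.Product.Properties using (≡-dec)
open import Data.Sum using (inj₁; inj₂)
open import Function using (_∘_)
open import Relation.Binary using (DecidableEquality; tri<; tri≈; tri>)
open import Relation.Binary.Construct.Closure.ReflexiveTransitive using (Star; ε; _◅_)
open import Relation.Binary.PropositionalEquality
  using (_≡_; _≢_; refl; sym; trans; cong; subst; subst₂)
open import Relation.Nullary using (¬_; yes; no; ¬?; contradiction; _×-dec_; _→-dec_)
open import Defs

private variable
  n : ℕ

-- Induction on `xs`: deleting the head `x` from `ys` strictly shortens `ys`, as `x` occurs there,
-- and still leaves room for the tail, which avoids `x`.
Unique∧⊆⇒length≤ : ∀ {A : Set} → DecidableEquality A → {xs ys : List A} →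
                   Unique xs → xs ⊆ ys → length xs ℕ.≤ length ys
Unique∧⊆⇒length≤ _ {[]} _ _ = ℕ.z≤n
Unique∧⊆⇒length≤ _≟A_ {x ∷ xs} {ys} (x∉xs ∷ xs!) xs⊆ys =
  ℕ.≤-<-trans (Unique∧⊆⇒length≤ _≟A_ xs! xs⊆ys∖x)
              (filter-notAll x≢? ys (lose (xs⊆ys (here refl)) (λ x≢x → x≢x refl)))
  where
  x≢? = λ y → ¬? (x ≟A y)

  xs⊆ys∖x : xs ⊆ filter x≢? ys
  xs⊆ys∖x y∈xs = ∈-filter⁺ x≢? (xs⊆ys (there y∈xs)) (lookup x∉xs y∈xs)

-- Normal form of an unordered pair; for distinct endpoints it is the orientation that `edges`
-- lists.
sort : Fin n → Fin n → Fin n × Fin n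
sort x y with x <? y
... | yes _ = x , y
... | no  _ = y , x

sort-< : {x y : Fin n} → x < y → sort x y ≡ (x , y)
sort-< {x = x} {y} x<y with x <? y
... | yes _  = refl
... | no x≮y = contradiction x<y x≮y

sort-comm : (x y : Fin n) → sort x y ≡ sort y x
sort-comm x y with <-cmp x y
... | tri≈ _ refl _ = refl
... | tri< x<y _ y≮x with x <? y | y <? x
...   | yes _  | no _    = refl
...   | _      | yes y<x = contradiction y<x y≮x
...   | no x≮y | _       = contradiction x<y x≮y
sort-comm x y | tri> x≮y _ y<x with x <? y | y <? x
...   | no _    | yes _  = refl
...   | yes x<y | _      = contradiction x<y x≮y
...   | _       | no y≮x = contradiction y<x y≮x

sort-cancelˡ : (v : Fin n) {x y : Fin n} → sort v x ≡ sort v y → x ≡ y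
sort-cancelˡ v {x} {y} eq with v <? x | v <? y
... | yes _ | yes _ = cong proj₂ eq
-- In the mixed cases `v` sits in different positions, so `x` and `y` both equal `v`.
... | yes _ | no  _ = trans (cong proj₂ eq) (cong proj₁ eq)
... | no  _ | yes _ = trans (cong proj₁ eq) (cong proj₂ eq)
... | no  _ | no  _ = cong proj₁ eq

sort-≢ : (x y : Fin n) {z : Fin n} → z ≢ x → z ≢ y → ∀ {t} → sort z t ≢ sort x y
sort-≢ x y {z} z≢x z≢y {t} eq with z <? t | x <? y
... | yes _ | yes _ = z≢x (cong proj₁ eq)
... | yes _ | no  _ = z≢y (cong proj₁ eq)
... | no  _ | yes _ = z≢y (cong proj₂ eq)
... | no  _ | no  _ = z≢x (cong proj₂ eq)

module _ (G : Graph n) where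

  edge? = λ ((x , y) : Fin n × Fin n) → (x <? y) ×-dec adj? G x y

  edges-unique : Unique (edges G)
  edges-unique = filter⁺ edge? (cartesianProduct⁺ (allFin⁺ n) (allFin⁺ n))

  ∈-edges⁻ : ∀ {x y} → (x , y) ∈ edges G → x < y × Adj G x y
  ∈-edges⁻ = proj₂ ∘ ∈-filter⁻ edge? {xs = cartesianProduct (allFin n) (allFin n)}

  ∈-edges⁺ : ∀ {x y} → x < y → Adj G x y → (x , y) ∈ edges G
  ∈-edges⁺ {x} {y} x<y xy =
    ∈-filter⁺ edge? (∈-cartesianProduct⁺ (∈-allFin x) (∈-allFin y)) (x<y , xy)

  sort-∈-edges : ∀ {x y} → Adj G x y → sort x y ∈ edges G
  sort-∈-edges {x} {y} xy with <-cmp x y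
  ... | tri< x<y _ _ = subst (_∈ edges G) (sym (sort-< x<y)) (∈-edges⁺ x<y xy)
  ... | tri≈ _ refl _ = contradiction xy (irrefl G)
  ... | tri> _ _ y<x =
    subst (_∈ edges G) (sym (trans (sort-comm x y) (sort-< y<x))) (∈-edges⁺ y<x (symm G xy))

  -- Completeness is decidable on finitely many vertices, so its failure yields a witness pair. The
  -- failing implication would hold vacuously if `x ≡ y` and outright if `x`, `y` were adjacent.
  ¬Complete⇒nonedge : ¬ Complete G → ∃[ x ] ∃[ y ] Nonedge G x y
  ¬Complete⇒nonedge ¬K =
    let adjacent? = λ x y → ¬? (x ≟ y) →-dec adj? G x y
        x , ¬Kx   = ¬∀⟶∃¬ n _ (λ x → all? (adjacent? x)) ¬K
        y , ¬xy   = ¬∀⟶∃¬ n _ (adjacent? x) ¬Kx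
    in x , y , (λ x≡y → ¬xy (contradiction x≡y)) , λ xy → ¬xy (λ _ → xy)

  -- Advance along the walk with `y` fixed, keeping the current vertex distinct from and nonadjacent
  -- to `y`. The first step to a neighbour `z` of `y` gives the common neighbour.
  walk⇒path₂ : ∀ {x y} → Star (Adj G) x y → Nonedge G x y →
               ∃[ u ] ∃[ v ] ∃[ w ] Nonedge G u v × Adj G u w × Adj G v w
  walk⇒path₂ ε (x≢x , _) = contradiction refl x≢x
  walk⇒path₂ {x} {y} (_◅_ {j = z} xz walk) (x≢y , x≁y) with adj? G z y
  ... | yes zy = x , y , z , (x≢y , x≁y) , xz , symm G zy
  ... | no z≁y = walk⇒path₂ walk ((λ { refl → x≁y xz }) , z≁y)

module _ (G : Graph (suc n)) {u v w : Fin (suc n)} (uv : Nonedge G u v)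
         (uw : Adj G u w) (vw : Adj G v w) where

  private
    v≢u : v ≢ u
    v≢u = proj₁ uv ∘ sym

    ι : Fin n → Fin (suc n)
    ι = punchIn v

    -- The quotient map on vertices: a left inverse of `ι` that sends `v` to the index of `u`.
    merge : Fin (suc n) → Fin n
    merge x with v ≟ x
    ... | yes _  = punchOut v≢u
    ... | no v≢x = punchOut v≢x

    merge-ι : ∀ a → merge (ι a) ≡ a
    merge-ι a with v ≟ ι a
    ... | yes v≡ιa = contradiction (sym v≡ιa) (punchInᵢ≢i v a)
    ... | no v≢ιa  = punchIn-injective v _ _ (punchIn-punchOut v≢ιa)

    merge-v : ∀ {a} → ι a ≡ u → merge v ≡ a
    merge-v ιa≡u with v ≟ v
    ... | yes _  = punchIn-injective v _ _ (trans (punchIn-punchOut v≢u) (sym ιa≡u))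
    ... | no v≢v = contradiction refl v≢v

    -- The induced map on edges, sorted again because moving `v` to the place of `u` can reverse an
    -- order.
    ψ : Fin (suc n) × Fin (suc n) → Fin n × Fin n
    ψ (x , y) = sort (merge x) (merge y)

    ψ-sort : ∀ x y → ψ (sort x y) ≡ sort (merge x) (merge y)
    ψ-sort x y with x <? y
    ... | yes _ = refl
    ... | no  _ = sort-comm (merge y) (merge x)

    ≢vw? = λ e → ¬? (≡-dec _≟_ _≟_ e (sort v w))

    edges∖vw : List (Fin (suc n) × Fin (suc n))
    edges∖vw = filter ≢vw? (edges G)

    image : ∀ {x y a b} → Adj G x y → sort x y ≢ sort v w →
            merge x ≡ a → merge y ≡ b → sort a b ∈ map ψ edges∖vw
    image {x} {y} xy ≢vw refl refl =
      subst (_∈ map ψ edges∖vw) (ψ-sort x y)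
            (∈-map⁺ ψ (∈-filter⁺ ≢vw? (sort-∈-edges G xy) ≢vw))

    -- The edge is its own preimage: `ι` misses `v`, so it cannot be `vw`.
    image-adj : ∀ a b → Adj G (ι a) (ι b) → sort a b ∈ map ψ edges∖vw
    image-adj a b ab = image ab ≢vw (merge-ι a) (merge-ι b)
      where
      ≢vw : sort (ι a) (ι b) ≢ sort v w
      ≢vw eq with ι a ≟ w
      ... | no ιa≢w = sort-≢ v w (punchInᵢ≢i v a) ιa≢w eq
      ... | yes refl =
        punchInᵢ≢i v b (sort-cancelˡ (ι a) (trans eq (sort-comm v (ι a))))

    -- The natural preimage joins `v` to `ι b`, which is forbidden when `ι b` is `w`. In that case
    -- `uw` is an edge between `ι a` and `ι b`, so the adjacent case has already covered it.
    image-inherited : ∀ a b → ι a ≡ u → Adj G v (ι b) → sort a b ∈ map ψ edges∖vw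
    image-inherited a b ιa≡u vb with adj? G (ι a) (ι b)
    ... | yes ab = image-adj a b ab
    ... | no a≁b = image vb ≢vw (merge-v ιa≡u) (merge-ι b)
      where
      ≢vw : sort v (ι b) ≢ sort v w
      ≢vw eq = a≁b (subst₂ (Adj G) (sym ιa≡u) (sym (sort-cancelˡ v eq)) uw)

    image-edge : ∀ {a b} → Adj (G / uv) a b → sort a b ∈ map ψ edges∖vw
    image-edge {a} {b} (inj₁ ab)                 = image-adj a b ab
    image-edge {a} {b} (inj₂ (inj₁ (ιa≡u , vb))) = image-inherited a b ιa≡u vb
    image-edge {a} {b} (inj₂ (inj₂ (ιb≡u , va))) =
      subst (_∈ map ψ edges∖vw) (sort-comm b a) (image-inherited b a ιb≡u va)

    edges⊆image : edges (G / uv) ⊆ map ψ edges∖vw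
    edges⊆image {a , b} e with ∈-edges⁻ (G / uv) e
    ... | a<b , ab = subst (_∈ map ψ edges∖vw) (sort-< a<b) (image-edge ab)

  -- The list of images may repeat edges, through further common neighbours of `u` and `v`; covering
  -- the duplicate-free `edges (G / uv)` is enough. Strictness comes from filtering out `vw`.
  ∣E∣-contract : ∣E∣ (G / uv) ℕ.< ∣E∣ G
  ∣E∣-contract = begin-strict
    ∣E∣ (G / uv)              ≤⟨ Unique∧⊆⇒length≤ (≡-dec _≟_ _≟_)
                                   (edges-unique (G / uv)) edges⊆image ⟩
    length (map ψ edges∖vw)   ≡⟨ length-map ψ edges∖vw ⟩
    length edges∖vw           <⟨ filter-notAll ≢vw? (edges G)
                                   (lose (sort-∈-edges G vw) (λ ≢vw → ≢vw refl)) ⟩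
    ∣E∣ G                     ∎
    where open ℕ.≤-Reasoning

  ℶ¹-contract : ℶ¹ (G / uv) ≤ ℶ¹ G
  ℶ¹-contract = subst₂ _≤_
    -- Raising both terms of `e ⊖ n` by one makes both sides subtract `suc n`, and the strict edge
    -- bound is then the required `suc e ≤ ∣E∣ G`.
    (trans ([1+m]⊖[1+n]≡m⊖n e n) (sym (m-n≡m⊖n e n)))
    (sym (m-n≡m⊖n (∣E∣ G) (suc n)))
    (⊖-monoˡ-≤ (suc n) ∣E∣-contract)
    where e = ∣E∣ (G / uv)

theorem2p2p1 : ∀ (n : ℕ) (G : Graph n) → Connected G → ¬ Complete G →
    ∃[ u ] ∃[ v ] Σ[ uv ∈ Nonedge G u v ] ℶ¹ (G / uv) ≤ ℶ¹ G
-- The graph without vertices is vacuously complete.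
theorem2p2p1 zero G _ ¬K = contradiction (λ ()) ¬K
theorem2p2p1 (suc n) G conn ¬K =
  let x , y , xy = ¬Complete⇒nonedge G ¬K
      u , v , w , uv , uw , vw = walk⇒path₂ G (conn x y) xy
  in u , v , uv , ℶ¹-contract G uv uw vw
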